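{- Let $A$ be a finite alphabet and let $u,w\in A^*$. Then $$\langle A^*\sqcup\!\sqcup_q u,\,w\rangle=\binom{w}{u}_q ,$$ where $A^*$ on the left-hand side is understood as the formal series all of whose coefficients are equal to $1$.
   Context: $A^*$ is the free monoid of finite words over $A$ (with concatenation and empty word $\varepsilon$), and $|w|$ is the length of a word $w$. The $q$-binomial coefficient $\binom{u}{v}_q\in\mathbb{N}[q]$ of two words $u,v\in A^*$ is defined recursively by $\binom{u}{\varepsilon}_q=1$, $\binom{\varepsilon}{v}_q=0$ if $v\neq\varepsilon$, and, for all $u,v\in A^*$ and letters $a,b\in A$, $\binom{ua}{vb}_q=q^{|vb|}\binom{u}{vb}_q+\delta_{a,b}\binom{u}{v}_q$, where $\delta_{a,b}$ is the Kronecker delta. $\mathbb{N}[q]\langle\langle A^*\rangle\rangle$ is the set of formal series, i.e. maps $A^*\to\mathbb{N}[q]$; $\langle s,w\rangle$ is the coefficient of the word $w$ in $s$; $\mathbb{N}[q]\langle A^*\rangle$ is the set of series with finite support. For $s\in\mathbb{N}[q]\langle A^*\rangle$ and a letter $a$, $sa$ is obtained by appending $a$ to each word of $s$. The $q$-shuffle $u\sqcup\!\sqcup_q v\in\mathbb{N}[q]\langle A^*\rangle$ of two words is defined recursively by $u\sqcup\!\sqcup_q\varepsilon=\varepsilon\sqcup\!\sqcup_q u=u$ and, for $u,v\in A^*$, $a,b\in A$, $ua\sqcup\!\sqcup_q vb=q^{|vb|}(u\sqcup\!\sqcup_q vb)a+(ua\sqcup\!\sqcup_q v)b$. For a series $s$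 and a word $u$, $s\sqcup\!\sqcup_q u=\sum_{v\in A^*}\langle s,v\rangle\,(v\sqcup\!\sqcup_q u)$; in particular $A^*\sqcup\!\sqcup_q u=\sum_{v\in A^*}v\sqcup\!\sqcup_q u$. -}

module Defs where

open import Algebra.Bundles using (CommutativeMonoid)
open import Data.Bool.Base using (true; false; if_then_else_)
open import Data.Fin.Base using (Fin)
open import Data.Fin.Properties using (inj⇒≟)
open import Data.List.Base
  using (List; []; _∷_; _++_; length; foldr; map; allFin; cartesianProductWith)
open import Data.List.Membership.Propositional using (_∈_; _∉_)
open import Data.List.Membership.Propositional.Properties
  using (∈-∃++; ∈-map⁺; ∈-allFin; ∈-cartesianProductWith⁺; ∈-cartesianProductWith⁻)
import Data.List.Membership.DecPropositional as DecMembership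
open import Data.List.Properties using (≡-dec; ∷-injective)
open import Data.List.Relation.Binary.Permutation.Propositional
  using (_↭_; refl; prep; swap; trans; ↭-sym; ↭⇒↭ₛ)
open import Data.List.Relation.Binary.Permutation.Propositional.Properties
  using (shift; ∈-resp-↭)
open import Data.List.Relation.Binary.Permutation.Setoid.Properties
  using (Unique-resp-↭)
open import Data.List.Relation.Unary.All as All using (All)
open import Data.List.Relation.Unary.Any using (here; there)
open import Data.List.Relation.Unary.AllPairs using ([]; _∷_)
open import Data.List.Relation.Unary.Unique.Propositional using (Unique)
open import Data.List.Relation.Unary.Unique.Propositional.Properties
  using (map⁺; allFin⁺; cartesianProductWith⁺)
open import Data.Nat.Base as ℕ using (ℕ; zero; suc; s≤s)
open import Data.Nat.Properties as ℕₚ using ()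
open import Data.Product.Base using (_,_; proj₁; proj₂)
open import Function.Base using (_∘_; flip)
open import Function.Bundles using (_↔_; module Inverse; module Injection)
open import Function.Properties.Inverse using (↔⇒↣; ↔-sym)
open import Level using (Level; 0ℓ)
open import Relation.Binary.Definitions using (DecidableEquality)
open import Relation.Binary.PropositionalEquality as ≡
  using (_≡_; _≢_; cong; cong₂; subst)
open import Relation.Nullary.Decidable using (yes; no; does)
open import Relation.Nullary.Negation using (contradiction)

-- A polynomial is the list of its coefficients, constant term first.
-- Trailing zeros are allowed, so equality of polynomials is _≈_ below
-- rather than _≡_.

ℕ[q] : Set
ℕ[q] = List ℕ

coeff : ℕ[q] → ℕ → ℕ
coeff []      _       = 0
coeff (a ∷ p) zero    = a
coeff (a ∷ p) (suc n) = coeff p n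

infix  4 _≈_
infixl 6 _+_
infixl 7 _*_
infix  8 q^_

-- A record, so that p and r can be inferred from a proof of p ≈ r.

record _≈_ (p r : ℕ[q]) : Set where
  constructor coeffwise
  field coeff-≡ : ∀ n → coeff p n ≡ coeff r n

open _≈_ public

0# 1# : ℕ[q]
0# = []
1# = 1 ∷ []

q^_ : ℕ → ℕ[q]
q^ zero  = 1#
q^ suc n = 0 ∷ q^ n

_+_ : ℕ[q] → ℕ[q] → ℕ[q]
[]      + r       = r
(a ∷ p) + []      = a ∷ p
(a ∷ p) + (b ∷ r) = (a ℕ.+ b) ∷ (p + r)

-- (a + q p) r = a r + q (p r)

_*_ : ℕ[q] → ℕ[q] → ℕ[q]
[]      * r = []
(a ∷ p) * r = map (a ℕ.*_) r + (0 ∷ p * r)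

coeff-+ : ∀ p r n → coeff (p + r) n ≡ coeff p n ℕ.+ coeff r n
coeff-+ []      r       n       = ≡.refl
coeff-+ (a ∷ p) []      n       = ≡.sym (ℕₚ.+-identityʳ _)
coeff-+ (a ∷ p) (b ∷ r) zero    = ≡.refl
coeff-+ (a ∷ p) (b ∷ r) (suc n) = coeff-+ p r n

coeff-map : ∀ a r n → coeff (map (a ℕ.*_) r) n ≡ a ℕ.* coeff r n
coeff-map a []      n       = ≡.sym (ℕₚ.*-zeroʳ a)
coeff-map a (b ∷ r) zero    = ≡.refl
coeff-map a (b ∷ r) (suc n) = coeff-map a r n

≈-refl : ∀ {p} → p ≈ p
≈-refl = coeffwise λ _ → ≡.refl

≈-sym : ∀ {p r} → p ≈ r → r ≈ p
≈-sym e = coeffwise λ n → ≡.sym (coeff-≡ e n)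

≈-trans : ∀ {p r s} → p ≈ r → r ≈ s → p ≈ s
≈-trans e f = coeffwise λ n → ≡.trans (coeff-≡ e n) (coeff-≡ f n)

+-cong : ∀ {p p′ r r′} → p ≈ p′ → r ≈ r′ → p + r ≈ p′ + r′
+-cong {p} {p′} {r} {r′} e f = coeffwise λ n → begin
  coeff (p + r) n             ≡⟨ coeff-+ p r n ⟩
  coeff p n ℕ.+ coeff r n     ≡⟨ cong₂ ℕ._+_ (coeff-≡ e n) (coeff-≡ f n) ⟩
  coeff p′ n ℕ.+ coeff r′ n   ≡⟨ coeff-+ p′ r′ n ⟨
  coeff (p′ + r′) n           ∎
  where open ≡.≡-Reasoning

+-assoc : ∀ p r s → (p + r) + s ≈ p + (r + s)
+-assoc p r s = coeffwise λ n → begin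
  coeff (p + r + s) n                        ≡⟨ coeff-+ (p + r) s n ⟩
  coeff (p + r) n ℕ.+ coeff s n              ≡⟨ cong (ℕ._+ coeff s n) (coeff-+ p r n) ⟩
  coeff p n ℕ.+ coeff r n ℕ.+ coeff s n      ≡⟨ ℕₚ.+-assoc (coeff p n) _ _ ⟩
  coeff p n ℕ.+ (coeff r n ℕ.+ coeff s n)    ≡⟨ cong (coeff p n ℕ.+_) (coeff-+ r s n) ⟨
  coeff p n ℕ.+ coeff (r + s) n              ≡⟨ coeff-+ p (r + s) n ⟨
  coeff (p + (r + s)) n                      ∎
  where open ≡.≡-Reasoning

+-comm : ∀ p r → p + r ≈ r + p
+-comm p r = coeffwise λ n → begin
  coeff (p + r) n          ≡⟨ coeff-+ p r n ⟩
  coeff p n ℕ.+ coeff r n  ≡⟨ ℕₚ.+-comm (coeff p n) _ ⟩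
  coeff r n ℕ.+ coeff p n  ≡⟨ coeff-+ r p n ⟨
  coeff (r + p) n          ∎
  where open ≡.≡-Reasoning

+-identityʳ : ∀ p → p + 0# ≈ p
+-identityʳ p = +-comm p 0#

+-commutativeMonoid : CommutativeMonoid 0ℓ 0ℓ
+-commutativeMonoid = record
  { Carrier = ℕ[q] ; _≈_ = _≈_ ; _∙_ = _+_ ; ε = 0#
  ; isCommutativeMonoid = record
    { isMonoid = record
      { isSemigroup = record
        { isMagma = record
          { isEquivalence = record
            { refl = ≈-refl ; sym = ≈-sym ; trans = ≈-trans }
          ; ∙-cong = +-cong
          }
        ; assoc = +-assoc
        }
      ; identity = (λ _ → ≈-refl) , +-identityʳ
      }
    ; comm = +-comm
    }
  }

*-zeroʳ : ∀ p {r} → r ≈ 0# → p * r ≈ 0#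
*-zeroʳ []      e = ≈-refl
*-zeroʳ (a ∷ p) {r} e = +-cong {r′ = 0#} scaled shifted
  where
  scaled : map (a ℕ.*_) r ≈ 0#
  scaled = coeffwise λ n → ≡.trans (coeff-map a r n)
    (≡.trans (cong (a ℕ.*_) (coeff-≡ e n)) (ℕₚ.*-zeroʳ a))
  shifted : 0 ∷ p * r ≈ 0#
  shifted = coeffwise λ where
    zero    → ≡.refl
    (suc n) → coeff-≡ (*-zeroʳ p e) n

module Words {a : Level} {A : Set a} {k : ℕ} (finite : A ↔ Fin k) where

  -- All recursions below are on the last letter of a word, so a word is
  -- stored with its last letter at the head of the list: u ▹ a is the
  -- word ua.

  Word : Set a
  Word = List A

  infixl 9 _▹_

  pattern ε       = []
  pattern _▹_ u a = a ∷ u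

  _≟ᴬ_ : DecidableEquality A
  _≟ᴬ_ = inj⇒≟ (↔⇒↣ finite)

  _≟ᵂ_ : DecidableEquality Word
  _≟ᵂ_ = ≡-dec _≟ᴬ_

  δ : A → A → ℕ[q]
  δ a b = if does (a ≟ᴬ b) then 1# else 0#

  binom : Word → Word → ℕ[q]
  binom u       ε       = 1#
  binom ε       (v ▹ b) = 0#
  binom (u ▹ a) (v ▹ b) =
    q^ length (v ▹ b) * binom u (v ▹ b) + δ a b * binom u v

  Series : Set a
  Series = Word → ℕ[q]

  ⟨_,_⟩ : Series → Word → ℕ[q]
  ⟨ s , w ⟩ = s w

  A* : Series
  A* w = 1#

  word : Word → Series
  word u w = if does (u ≟ᵂ w) then 1# else 0#

  infixl 6 _⊕_
  infixr 7 _·_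
  infixl 8 _◃_

  _⊕_ : Series → Series → Series
  (s ⊕ t) w = ⟨ s , w ⟩ + ⟨ t , w ⟩

  _·_ : ℕ[q] → Series → Series
  (p · s) w = p * ⟨ s , w ⟩

  -- s ◃ a is the series sa.

  _◃_ : Series → A → Series
  (s ◃ a) ε       = 0#
  (s ◃ a) (w ▹ b) = if does (a ≟ᴬ b) then ⟨ s , w ⟩ else 0#

  infixl 7 _⧢_ _⧢ˢ_

  _⧢_ : Word → Word → Series
  u         ⧢ ε         = word u
  ε         ⧢ v@(_ ▹ _) = word v
  u′@(u ▹ a) ⧢ v′@(v ▹ b) =
    q^ length v′ · (u ⧢ v′) ◃ a ⊕ (u′ ⧢ v) ◃ b

  record FiniteSupport (s : Series) : Set a where
    field
      support : List Word
      unique  : Unique support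
      outside : ∀ v → v ∉ support → ⟨ s , v ⟩ ≈ 0#

  sumOver : List Word → Series → ℕ[q]
  sumOver vs s = foldr (λ v p → ⟨ s , v ⟩ + p) 0# vs

  ∑ : (s : Series) → FiniteSupport s → ℕ[q]
  ∑ s fin = sumOver (FiniteSupport.support fin) s

  -- The list called support may also contain zeros of s; the sum does
  -- not depend on its choice.

  sumOver-↭ : ∀ s {vs ws} → vs ↭ ws → sumOver vs s ≈ sumOver ws s
  sumOver-↭ s refl         = ≈-refl
  sumOver-↭ s (prep x e)   = +-cong ≈-refl (sumOver-↭ s e)
  sumOver-↭ s (swap {xs} {ys} x y e) =
    ≈-trans (≈-sym (+-assoc (s x) (s y) (sumOver xs s)))
      (≈-trans (+-cong (+-comm (s x) (s y)) (sumOver-↭ s e))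
        (+-assoc (s y) (s x) (sumOver ys s)))
  sumOver-↭ s (trans e f)  = ≈-trans (sumOver-↭ s e) (sumOver-↭ s f)

  sumOver-zero : ∀ s vs → (∀ v → v ∈ vs → s v ≈ 0#) → sumOver vs s ≈ 0#
  sumOver-zero s []       z = ≈-refl
  sumOver-zero s (v ∷ vs) z =
    +-cong {r′ = 0#} (z v (here ≡.refl)) (sumOver-zero s vs λ w → z w ∘ there)

  sumOver-unique : ∀ s vs ws → Unique vs → Unique ws →
    (∀ v → v ∈ vs → v ∉ ws → s v ≈ 0#) →
    (∀ v → v ∈ ws → v ∉ vs → s v ≈ 0#) →
    sumOver vs s ≈ sumOver ws s
  sumOver-unique s [] ws _ _ _ z =
    ≈-sym (sumOver-zero s ws λ v v∈ → z v v∈ λ ())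
  sumOver-unique s (x ∷ vs) ws (x# ∷ uvs) uws y z
    with DecMembership._∈?_ _≟ᵂ_ x ws
  ... | no x∉ws = +-cong {p′ = 0#} (y x (here ≡.refl) x∉ws)
    (sumOver-unique s vs ws uvs uws (λ v → y v ∘ there)
      λ v v∈ws v∉vs → z v v∈ws λ where
        (here ≡.refl) → x∉ws v∈ws
        (there v∈vs)  → v∉vs v∈vs)
  ... | yes x∈ws with ∈-∃++ x∈ws
  ... | ws₁ , ws₂ , ≡.refl
    with Unique-resp-↭ (≡.setoid Word) (↭⇒↭ₛ (shift x ws₁ ws₂)) uws
  ... | x#′ ∷ uws′ = ≈-trans
    (+-cong (≈-refl {s x})
      (sumOver-unique s vs (ws₁ ++ ws₂) uvs uws′
        (λ v v∈vs v∉ws′ → y v (there v∈vs) λ v∈ws →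
          case-∈ (∈-resp-↭ (shift x ws₁ ws₂) v∈ws)
            (λ where ≡.refl → All.lookup x# v∈vs ≡.refl) v∉ws′)
        (λ v v∈ws′ v∉vs → z v (∈-resp-↭ (↭-sym (shift x ws₁ ws₂)) (there v∈ws′)) λ where
          (here ≡.refl) → All.lookup x#′ v∈ws′ ≡.refl
          (there v∈vs)  → v∉vs v∈vs)))
    (sumOver-↭ s (↭-sym (shift x ws₁ ws₂)))
    where
    case-∈ : ∀ {v us} {C : Set} → v ∈ (x ∷ us) → (v ≡ x → C) → (v ∈ us → C) → C
    case-∈ (here e)  f g = f e
    case-∈ (there i) f g = g i

  ∑-unique : ∀ s (f g : FiniteSupport s) → ∑ s f ≈ ∑ s g
  ∑-unique s f g = sumOver-unique s F.support G.support F.unique G.unique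
    (λ v _ → G.outside v) (λ v _ → F.outside v)
    where
    module F = FiniteSupport f
    module G = FiniteSupport g

  letters : List A
  letters = map (Inverse.from finite) (allFin k)

  ∈-letters : ∀ a → a ∈ letters
  ∈-letters a = subst (_∈ letters) (Inverse.strictlyInverseʳ finite a)
    (∈-map⁺ (Inverse.from finite) (∈-allFin (Inverse.to finite a)))

  letters-unique : Unique letters
  letters-unique = map⁺ (Injection.injective (↔⇒↣ (↔-sym finite))) (allFin⁺ k)

  wordsUpTo : ℕ → List Word
  wordsUpTo zero    = ε ∷ []
  wordsUpTo (suc n) = ε ∷ cartesianProductWith _▹_ (wordsUpTo n) letters

  ∈-wordsUpTo : ∀ {n} v → length v ℕ.≤ n → v ∈ wordsUpTo n
  ∈-wordsUpTo {zero}  ε       _         = here ≡.refl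
  ∈-wordsUpTo {suc n} ε       _         = here ≡.refl
  ∈-wordsUpTo {suc n} (v ▹ a) (s≤s v≤n) =
    there (∈-cartesianProductWith⁺ _▹_ (∈-wordsUpTo v v≤n) (∈-letters a))

  wordsUpTo-unique : ∀ n → Unique (wordsUpTo n)
  wordsUpTo-unique zero    = All.[] ∷ []
  wordsUpTo-unique (suc n) =
    All.tabulate nonempty ∷
    cartesianProductWith⁺ _▹_
      (λ e → proj₂ (∷-injective e) , proj₁ (∷-injective e))
      (wordsUpTo-unique n) letters-unique
    where
    nonempty : ∀ {v} → v ∈ cartesianProductWith _▹_ (wordsUpTo n) letters → ε ≢ v
    nonempty v∈ ≡.refl with ∈-cartesianProductWith⁻ _▹_ (wordsUpTo n) letters v∈
    ... | _ , _ , _ , _ , ()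

  boundedSupport : ∀ {s} n → (∀ v → n ℕ.< length v → ⟨ s , v ⟩ ≈ 0#) → FiniteSupport s
  boundedSupport n z = record
    { support = wordsUpTo n
    ; unique  = wordsUpTo-unique n
    ; outside = λ v v∉ → z v (ℕₚ.≰⇒> (v∉ ∘ ∈-wordsUpTo v))
    }

  ◃-vanish : ∀ s a {n} → (∀ w → length w ≢ n → ⟨ s , w ⟩ ≈ 0#) →
             ∀ w → length w ≢ suc n → ⟨ s ◃ a , w ⟩ ≈ 0#
  ◃-vanish s a z ε       _  = ≈-refl
  ◃-vanish s a z (w ▹ b) ne with does (a ≟ᴬ b)
  ... | true  = z w (ne ∘ cong suc)
  ... | false = ≈-refl

  word-vanish : ∀ u w → length w ≢ length u → ⟨ word u , w ⟩ ≈ 0#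
  word-vanish u w ne with u ≟ᵂ w
  ... | yes ≡.refl = contradiction ≡.refl ne
  ... | no _       = ≈-refl

  ⧢-vanish : ∀ u v w → length w ≢ length u ℕ.+ length v → ⟨ u ⧢ v , w ⟩ ≈ 0#
  ⧢-vanish u ε w ne =
    word-vanish u w (ne ∘ flip ≡.trans (≡.sym (ℕₚ.+-identityʳ (length u))))
  ⧢-vanish ε       (v ▹ b) w ne = word-vanish (v ▹ b) w ne
  ⧢-vanish (u ▹ a) (v ▹ b) w ne = +-cong {r′ = 0#}
    (*-zeroʳ (q^ length (v ▹ b))
      (◃-vanish (u ⧢ (v ▹ b)) a (⧢-vanish u (v ▹ b)) w ne))
    (◃-vanish ((u ▹ a) ⧢ v) b (⧢-vanish (u ▹ a) v) w
      (ne ∘ flip ≡.trans (≡.sym (cong suc (ℕₚ.+-suc (length u) (length v))))))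

  ⧢-finite : ∀ u v → FiniteSupport (u ⧢ v)
  ⧢-finite u v = boundedSupport (length u ℕ.+ length v)
    λ w lt → ⧢-vanish u v w (ℕₚ.>⇒≢ lt)

  -- For fixed w, the coefficient of w in v ⧢ u is nonzero for only
  -- finitely many v, so the sum over all words v is defined.

  ⧢ˢ-summable : ∀ s u w → FiniteSupport (λ v → ⟨ s , v ⟩ * ⟨ v ⧢ u , w ⟩)
  ⧢ˢ-summable s u w = boundedSupport (length w) λ v lt →
    *-zeroʳ ⟨ s , v ⟩ (⧢-vanish v u w
      (ℕₚ.<⇒≢ (ℕₚ.<-≤-trans lt (ℕₚ.m≤m+n (length v) (length u)))))

  _⧢ˢ_ : Series → Word → Series
  (s ⧢ˢ u) w = ∑ (λ v → ⟨ s , v ⟩ * ⟨ v ⧢ u , w ⟩) (⧢ˢ-summable s u w)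

{-# OPTIONS --safe #-}

-- For fixed words ub and wc, the recursions defining v ⧢ ub combine into a single
-- identity valid for every word v, including ε:
--   ⟨ v ⧢ ub , wc ⟩ = q^|ub| [v ends with c] ⟨ vc⁻¹ ⧢ ub , w ⟩ + δ_{b,c} ⟨ v ⧢ u , w ⟩.
-- Summed over all v of length at most n + 1, the first term runs over all words
-- of length at most n, so the sum obeys the recursion of the q-binomial.
-- The length bound is any n ≥ |w|, because the second term lowers |w| but not n.

module Submission where

open import Defs
open import Algebra.Bundles using (module CommutativeMonoid)
open import Algebra.Properties.CommutativeSemigroup
  (CommutativeMonoid.commutativeSemigroup +-commutativeMonoid) using (interchange)
open import Data.Bool.Base using (true; false)
open import Data.Fin.Base using (Fin)
open import Data.List.Base using ([]; _∷_; length; map)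
open import Data.List.Membership.Propositional using (_∈_; _∉_)
open import Data.List.Membership.Propositional.Properties
  using (∈-map⁺; ∈-map⁻; ∈-cartesianProductWith⁺; ∈-cartesianProductWith⁻)
open import Data.List.Relation.Unary.All using ([])
open import Data.List.Relation.Unary.AllPairs using ([]; _∷_)
open import Data.List.Relation.Unary.Any using (here; there)
open import Data.List.Properties using (∷-injectiveʳ)
open import Data.List.Relation.Unary.Unique.Propositional.Properties using (map⁺)
open import Data.Nat.Base as ℕ using (ℕ; zero; suc; s≤s; z≤n)
open import Data.Nat.Properties as ℕₚ using ()
open import Data.Product.Base using (_,_)
open import Function.Base using (_∘_)
open import Function.Bundles using (_↔_; mk⇔)
open import Level using (Level)
open import Relation.Binary.PropositionalEquality as ≡ using (_≡_; _≢_; cong; cong₂)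
open import Relation.Nullary.Decidable using (yes; no; does; dec-true; dec-false; does-⇔)
open import Relation.Nullary.Negation using (contradiction)
import Relation.Binary.Reasoning.Setoid as SetoidReasoning

open SetoidReasoning (CommutativeMonoid.setoid +-commutativeMonoid)

0∷-cong : ∀ {p r} → p ≈ r → (0 ∷ p) ≈ (0 ∷ r)
0∷-cong e = coeffwise λ where
  zero    → ≡.refl
  (suc n) → coeff-≡ e n

map-*-cong : ∀ m {r s} → r ≈ s → map (m ℕ.*_) r ≈ map (m ℕ.*_) s
map-*-cong m {r} {s} e = coeffwise λ n →
  ≡.trans (coeff-map m r n)
    (≡.trans (cong (m ℕ.*_) (coeff-≡ e n)) (≡.sym (coeff-map m s n)))

map-*-distrib-+ : ∀ m r s →
  map (m ℕ.*_) (r + s) ≈ map (m ℕ.*_) r + map (m ℕ.*_) s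
map-*-distrib-+ m r s = coeffwise λ n →
  ≡.trans (coeff-map m (r + s) n)
    (≡.trans (cong (m ℕ.*_) (coeff-+ r s n))
      (≡.trans (ℕₚ.*-distribˡ-+ m (coeff r n) (coeff s n))
        (≡.trans (cong₂ ℕ._+_ (≡.sym (coeff-map m r n)) (≡.sym (coeff-map m s n)))
          (≡.sym (coeff-+ (map (m ℕ.*_) r) (map (m ℕ.*_) s) n)))))

*-congˡ : ∀ p {r s} → r ≈ s → p * r ≈ p * s
*-congˡ []      e = ≈-refl
*-congˡ (m ∷ p) e = +-cong (map-*-cong m e) (0∷-cong (*-congˡ p e))

*-distribˡ-+ : ∀ p r s → p * (r + s) ≈ p * r + p * s
*-distribˡ-+ []      r s = ≈-refl
*-distribˡ-+ (m ∷ p) r s = begin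
  map (m ℕ.*_) (r + s) + (0 ∷ p * (r + s))
    ≈⟨ +-cong (map-*-distrib-+ m r s) (0∷-cong (*-distribˡ-+ p r s)) ⟩
  (map (m ℕ.*_) r + map (m ℕ.*_) s) + ((0 ∷ p * r) + (0 ∷ p * s))
    ≈⟨ interchange (map (m ℕ.*_) r) (map (m ℕ.*_) s) (0 ∷ p * r) (0 ∷ p * s) ⟩
  (m ∷ p) * r + (m ∷ p) * s ∎

-- `1# * p` unfolds to `map (1 ℕ.*_) p + (0 ∷ [])`. The extra list is zero only up to `_≈_`, hence
-- the comparison of coefficients.
*-identityˡ : ∀ p → 1# * p ≈ p
*-identityˡ p = coeffwise λ n →
  ≡.trans (coeff-+ (map (1 ℕ.*_) p) (0 ∷ []) n)
    (≡.trans (cong₂ ℕ._+_ (≡.trans (coeff-map 1 p n) (ℕₚ.*-identityˡ _)) (zeros n))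
      (ℕₚ.+-identityʳ _))
  where
  zeros : ∀ n → coeff (0 ∷ []) n ≡ 0
  zeros zero    = ≡.refl
  zeros (suc n) = ≡.refl

module _ {a : Level} {A : Set a} {k : ℕ} (finite : A ↔ Fin k) where
  open Words finite

  sumOver-cong : ∀ {s t} → (∀ v → s v ≈ t v) → ∀ vs → sumOver vs s ≈ sumOver vs t
  sumOver-cong e []       = ≈-refl
  sumOver-cong e (v ∷ vs) = +-cong (e v) (sumOver-cong e vs)

  sumOver-⊕ : ∀ s t vs → sumOver vs (s ⊕ t) ≈ sumOver vs s + sumOver vs t
  sumOver-⊕ s t []       = ≈-refl
  sumOver-⊕ s t (v ∷ vs) = ≈-trans (+-cong ≈-refl (sumOver-⊕ s t vs))
    (interchange (s v) (t v) (sumOver vs s) (sumOver vs t))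

  sumOver-· : ∀ p s vs → sumOver vs (p · s) ≈ p * sumOver vs s
  sumOver-· p s []       = ≈-sym (*-zeroʳ p ≈-refl)
  sumOver-· p s (v ∷ vs) = ≈-trans (+-cong ≈-refl (sumOver-· p s vs))
    (≈-sym (*-distribˡ-+ p (s v) (sumOver vs s)))

  ◃-▹ : ∀ s c v → (s ◃ c) (v ▹ c) ≡ s v
  ◃-▹ s c v rewrite dec-true (c ≟ᴬ c) ≡.refl = ≡.refl

  sumOver-map-◃ : ∀ s c vs → sumOver (map (_▹ c) vs) (s ◃ c) ≡ sumOver vs s
  sumOver-map-◃ s c []       = ≡.refl
  sumOver-map-◃ s c (v ∷ vs) = cong₂ _+_ (◃-▹ s c v) (sumOver-map-◃ s c vs)

  -- Appending `c` maps the words of length at most n bijectively onto the words of length at most n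
  -- + 1 that end with `c`; outside these, `s ◃ c` is zero.
  sumOver-◃ : ∀ s c n →
    sumOver (wordsUpTo (suc n)) (s ◃ c) ≈ sumOver (wordsUpTo n) s
  sumOver-◃ s c n = begin
    sumOver (wordsUpTo (suc n)) (s ◃ c)
      ≈⟨ sumOver-unique (s ◃ c) (wordsUpTo (suc n)) (map (_▹ c) (wordsUpTo n))
           (wordsUpTo-unique (suc n)) (map⁺ ∷-injectiveʳ (wordsUpTo-unique n))
           vanish
           (λ v v∈ v∉ → contradiction (included v v∈) v∉) ⟩
    sumOver (map (_▹ c) (wordsUpTo n)) (s ◃ c)
      ≡⟨ sumOver-map-◃ s c (wordsUpTo n) ⟩
    sumOver (wordsUpTo n) s ∎
    where
    included : ∀ v → v ∈ map (_▹ c) (wordsUpTo n) → v ∈ wordsUpTo (suc n)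
    included v v∈ with ∈-map⁻ (_▹ c) v∈
    ... | _ , x∈ , ≡.refl = there (∈-cartesianProductWith⁺ _▹_ x∈ (∈-letters c))

    vanish : ∀ v → v ∈ wordsUpTo (suc n) → v ∉ map (_▹ c) (wordsUpTo n) →
             (s ◃ c) v ≈ 0#
    vanish ε       _          _  = ≈-refl
    vanish (v ▹ b) (there v∈) v∉ with c ≟ᴬ b
    ... | no c≢b rewrite dec-false (c ≟ᴬ b) c≢b = ≈-refl
    -- A listed word ending with `c` has its prefix in `wordsUpTo n`, so it lies in the image after
    -- all.
    ... | yes ≡.refl with ∈-cartesianProductWith⁻ _▹_ (wordsUpTo n) letters v∈
    ... | _ , _ , x∈ , _ , ≡.refl = contradiction (∈-map⁺ (_▹ c) x∈) v∉

  -- `_◃_` tests the appended letter against the last letter of the evaluated word, while `binom`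
  -- takes the two letters in the opposite order.
  ≟ᴬ-sym : ∀ b c → does (b ≟ᴬ c) ≡ does (c ≟ᴬ b)
  ≟ᴬ-sym b c = does-⇔ (mk⇔ ≡.sym ≡.sym) (b ≟ᴬ c) (c ≟ᴬ b)

  ◃-δ : ∀ s b c w → (s ◃ b) (w ▹ c) ≈ δ c b * s w
  ◃-δ s b c w rewrite ≟ᴬ-sym b c with does (c ≟ᴬ b)
  ... | true  = ≈-sym (*-identityˡ (s w))
  ... | false = ≈-refl

  -- Both sides are `f v w` if `c` equals `d` and zero otherwise. This turns a condition on the word
  -- whose coefficient is read into one on the summation variable `v`.
  ◃-transpose : ∀ (f : Word → Series) v d w c →
    (f v ◃ d) (w ▹ c) ≡ ((λ v → f v w) ◃ c) (v ▹ d)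
  ◃-transpose f v d w c rewrite ≟ᴬ-sym d c = ≡.refl

  -- `_⧢_` splits on its second argument first, so `ε ⧢ u` does not reduce for a variable `u`.
  ε-⧢ : ∀ u → ε ⧢ u ≡ word u
  ε-⧢ ε       = ≡.refl
  ε-⧢ (u ▹ b) = ≡.refl

  word-▹ : ∀ u b w c → word (u ▹ b) (w ▹ c) ≡ (word u ◃ b) (w ▹ c)
  word-▹ u b w c with does (b ≟ᴬ c)
  ... | true  = ≡.refl
  ... | false = ≡.refl

  ⧢-▹ : ∀ u b w c v → ⟨ v ⧢ (u ▹ b) , w ▹ c ⟩ ≈
    ((q^ length (u ▹ b) · (λ v → ⟨ v ⧢ (u ▹ b) , w ⟩) ◃ c) ⊕
      (δ c b · (λ v → ⟨ v ⧢ u , w ⟩))) v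
  ⧢-▹ u b w c ε = begin
    word (u ▹ b) (w ▹ c)      ≡⟨ word-▹ u b w c ⟩
    (word u ◃ b) (w ▹ c)      ≈⟨ ◃-δ (word u) b c w ⟩
    δ c b * word u w          ≡⟨ cong (λ s → δ c b * s w) (ε-⧢ u) ⟨
    -- The empty word does not end with `c`, so the first term of the identity is a multiple of `0#`
    -- and can be inserted.
    δ c b * ⟨ ε ⧢ u , w ⟩     ≈⟨ +-cong (*-zeroʳ (q^ length (u ▹ b)) ≈-refl) ≈-refl ⟨
    q^ length (u ▹ b) * 0# + δ c b * ⟨ ε ⧢ u , w ⟩ ∎
  ⧢-▹ u b w c (v ▹ d) = +-cong
    (CommutativeMonoid.reflexive +-commutativeMonoid
      (cong (q^ length (u ▹ b) *_) (◃-transpose (_⧢ (u ▹ b)) v d w c)))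
    (◃-δ ((v ▹ d) ⧢ u) b c w)

  -- Only `v = w` contributes, and the length bound ensures that `w` is listed.
  sumOver-word : ∀ n w → length w ℕ.≤ n → sumOver (wordsUpTo n) (λ v → word v w) ≈ 1#
  sumOver-word n w w≤n = begin
    sumOver (wordsUpTo n) (λ v → word v w)
      ≈⟨ sumOver-unique (λ v → word v w) (wordsUpTo n) (w ∷ [])
           (wordsUpTo-unique n) ([] ∷ [])
           (λ v _ v∉ → vanish v (v∉ ∘ here))
           (λ where v (here ≡.refl) w∉ → contradiction (∈-wordsUpTo w w≤n) w∉) ⟩
    word w w + 0#  ≈⟨ +-identityʳ (word w w) ⟩
    word w w       ≡⟨ word-refl ⟩
    1#             ∎
    where
    vanish : ∀ v → v ≢ w → word v w ≈ 0#
    vanish v v≢w with v ≟ᵂ w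
    ... | yes e = contradiction e v≢w
    ... | no _  = ≈-refl
    word-refl : word w w ≡ 1#
    word-refl rewrite dec-true (w ≟ᵂ w) ≡.refl = ≡.refl

  sumOver-⧢ : ∀ u w n → length w ℕ.≤ n →
    sumOver (wordsUpTo n) (λ v → ⟨ v ⧢ u , w ⟩) ≈ binom w u
  sumOver-⧢ ε       w n w≤n = sumOver-word n w w≤n
  -- Every word in the shuffle of `v` with the nonempty `u ▹ b` has positive length, so none is `ε`.
  sumOver-⧢ (u ▹ b) ε n _ = sumOver-zero _ (wordsUpTo n) λ v _ →
    ⧢-vanish v (u ▹ b) ε
      (ℕₚ.<⇒≢ (ℕₚ.<-≤-trans (s≤s z≤n) (ℕₚ.m≤n+m (suc (length u)) (length v))))
  sumOver-⧢ (u ▹ b) (w ▹ c) (suc n) (s≤s w≤n) = begin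
    sumOver V (λ v → ⟨ v ⧢ (u ▹ b) , w ▹ c ⟩)
      ≈⟨ sumOver-cong (⧢-▹ u b w c) V ⟩
    sumOver V (q · s ◃ c ⊕ δ c b · t)
      ≈⟨ sumOver-⊕ (q · s ◃ c) (δ c b · t) V ⟩
    sumOver V (q · s ◃ c) + sumOver V (δ c b · t)
      ≈⟨ +-cong (sumOver-· q (s ◃ c) V) (sumOver-· (δ c b) t V) ⟩
    q * sumOver V (s ◃ c) + δ c b * sumOver V t
      -- Both induction hypotheses concern the shorter word `w`: the first with the bound lowered to
      -- n by `sumOver-◃`, the second still with n + 1.
      ≈⟨ +-cong (*-congˡ q (≈-trans (sumOver-◃ s c n) (sumOver-⧢ (u ▹ b) w n w≤n)))
                (*-congˡ (δ c b) (sumOver-⧢ u w (suc n) (ℕₚ.m≤n⇒m≤1+n w≤n))) ⟩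
    q * binom w (u ▹ b) + δ c b * binom w u ∎
    where
    V = wordsUpTo (suc n)
    q = q^ length (u ▹ b)
    s t : Series
    s v = ⟨ v ⧢ (u ▹ b) , w ⟩
    t v = ⟨ v ⧢ u , w ⟩

proposition5p7 : ∀ {a : Level} {A : Set a} {k : ℕ} (finite : A ↔ Fin k) →
    let open Words finite in
    (u w : Word) → ⟨ A* ⧢ˢ u , w ⟩ ≈ binom w u
proposition5p7 finite u w = ≈-trans
  -- The sum defining `_⧢ˢ_` unfolds to one over `wordsUpTo (length w)`, the support chosen in
  -- `⧢ˢ-summable`, with each term multiplied by the coefficient `1#` of `A*`.
  (sumOver-cong finite (λ v → *-identityˡ ⟨ v ⧢ u , w ⟩) (wordsUpTo (length w)))
  (sumOver-⧢ finite u w (length w) ℕₚ.≤-refl)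
  where open Words finite
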